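{- Greedy-weight is an $O(\log|X|)$-approximation for $\mathrm{MFD}_{\mathbb N}$ on series-parallel graphs. That is, there is an absolute constant $C>0$ such that for every series-parallel graph $G=(V,E)$ with terminals $s,t$ and every flow $X\colon E\to\mathbb N$ with $|X|\ge 2$, the number of paths used by greedy-weight to decompose $X$ is at most $C\cdot\log|X|\cdot\mathrm{mfd}_{\mathbb N}(G,X)$.
   Context: A (two-terminal) series-parallel graph with terminal nodes $s$ and $t$ is a directed graph (parallel edges allowed) that either consists of a single edge directed from $s$ to $t$ and no other nodes, or is obtained from two smaller series-parallel graphs $G_1,G_2$ with terminals $s_1,t_1$ and $s_2,t_2$, respectively, by either identifying $s=s_1=s_2$ and $t=t_1=t_2$ (parallel composition), or identifying $s=s_1$, $t_1=s_2$ and $t=t_2$ (series composition). A flow is a function $X$ on $E$ such that at every node of $V\setminus\{s,t\}$ incoming flow equals outgoing flow; $|X|$ is the total flow out of $s$. An $s$-$t$ path $P$ is identified with the flow that is $1$ on the edges of $P$ and $0$ elsewhere. A flow decomposition of $(G,X)$ of size $k$ with weights in $\mathbb N$ ($0\in\mathbb N$) is a family of $s$-$t$ paths $P_1,\dots,P_k$ with weights $w_1,\dots,w_k\in\mathbb N$ such that $X=w_1P_1+\dots+w_kP_k$; $\mathrm{mfd}_{\mathbb N}(G,X)$ is the smallest size of such a decomposition, and $\mathrm{MFD}_{\mathbb N}$ is the problem of finding one of smallest size. A path $P$ carries flow $p$ if $X(e)\ge p$ for every edge $e$ of $P$. Greedy-weight is the algorithm that, starting from $X$, repeatedly picks a heaviest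 path, i.e. an $s$-$t$ path carrying the largest possible flow $p$ in the current remaining flow (ties broken arbitrarily), adds it to the decomposition with weight $p$, and subtracts $p$ from the remaining flow on each of its edges, until the remaining flow is $0$. Logarithms are base $2$. -}

module Defs where

import Algebra.Properties.CommutativeMonoid.Sum
open import Data.Bool.Base using (if_then_else_)
open import Data.Fin.Base using (Fin)
open import Data.Fin.Properties using (_≟_)
open import Data.List.Base using (List; []; _∷_; map)
open import Data.List.Membership.Propositional using (_∈_)
import Data.List.Membership.DecPropositional as DecMembership
open import Data.List.Relation.Unary.Unique.Propositional using (Unique)
open import Data.Nat.Base using (ℕ; _*_; _∸_; _^_; _≤_)
open import Data.Nat.Properties using (+-0-commutativeMonoid)
open import Data.Product.Base using (∃-syntax; _×_; _,_)
open import Data.Sum.Base using (_⊎_; [_,_]′)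
open import Function.Base using (_∘_)
open import Function.Bundles using (_↔_; Inverse)
open import Function.Definitions using (Injective)
open import Relation.Binary.PropositionalEquality using (_≡_; _≢_)
open import Relation.Nullary using (¬_; does)

open Algebra.Properties.CommutativeMonoid.Sum +-0-commutativeMonoid public
  using (sum)

record Graph : Set where
  field
    #nodes #edges : ℕ

  Node : Set
  Node = Fin #nodes

  Edge : Set
  Edge = Fin #edges

  field
    src tgt : Edge → Node
    s t     : Node

open Graph

-- Identification of nodes is expressed by embeddings of the two parts into the composite, so the notions below do not depend on
-- how nodes and edges are named.

record SingleEdge (G : Graph) : Set where
  field
    s≢t      : s G ≢ t G
    only-s-t : ∀ v → v ≡ s G ⊎ v ≡ t G
    edge     : Edge G
    only     : ∀ e → e ≡ edge
    src-edge : src G edge ≡ s G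
    tgt-edge : tgt G edge ≡ t G

-- G is the union of copies of G₁ and G₂ that share no edges (but may share
-- nodes).
record EdgeDisjointUnion (G₁ G₂ G : Graph) : Set where
  field
    ι₁       : Node G₁ → Node G
    ι₂       : Node G₂ → Node G
    ι₁-inj   : Injective _≡_ _≡_ ι₁
    ι₂-inj   : Injective _≡_ _≡_ ι₂
    cover    : ∀ v → (∃[ u ] ι₁ u ≡ v) ⊎ (∃[ u ] ι₂ u ≡ v)
    edges    : (Edge G₁ ⊎ Edge G₂) ↔ Edge G
    src-edge : ∀ e → src G (Inverse.to edges e) ≡ [ ι₁ ∘ src G₁ , ι₂ ∘ src G₂ ]′ e
    tgt-edge : ∀ e → tgt G (Inverse.to edges e) ≡ [ ι₁ ∘ tgt G₁ , ι₂ ∘ tgt G₂ ]′ e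

record ParallelComposition (G₁ G₂ G : Graph) : Set where
  field
    union : EdgeDisjointUnion G₁ G₂ G
  open EdgeDisjointUnion union public
  field
    s≡s₁    : s G ≡ ι₁ (s G₁)
    s≡s₂    : s G ≡ ι₂ (s G₂)
    t≡t₁    : t G ≡ ι₁ (t G₁)
    t≡t₂    : t G ≡ ι₂ (t G₂)
    shared  : ∀ {u v} → ι₁ u ≡ ι₂ v →
              (u ≡ s G₁ × v ≡ s G₂) ⊎ (u ≡ t G₁ × v ≡ t G₂)

record SeriesComposition (G₁ G₂ G : Graph) : Set where
  field
    union : EdgeDisjointUnion G₁ G₂ G
  open EdgeDisjointUnion union public
  field
    s≡s₁    : s G ≡ ι₁ (s G₁)
    t₁≡s₂   : ι₁ (t G₁) ≡ ι₂ (s G₂)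
    t≡t₂    : t G ≡ ι₂ (t G₂)
    shared  : ∀ {u v} → ι₁ u ≡ ι₂ v → u ≡ t G₁ × v ≡ s G₂

data SeriesParallel (G : Graph) : Set where
  single   : SingleEdge G → SeriesParallel G
  parallel : ∀ {G₁ G₂} → SeriesParallel G₁ → SeriesParallel G₂ →
             ParallelComposition G₁ G₂ G → SeriesParallel G
  series   : ∀ {G₁ G₂} → SeriesParallel G₁ → SeriesParallel G₂ →
             SeriesComposition G₁ G₂ G → SeriesParallel G

module _ (G : Graph) where

  EdgeFun : Set
  EdgeFun = Edge G → ℕ

  inflow outflow : EdgeFun → Node G → ℕ
  inflow  X v = sum λ e → if does (tgt G e ≟ v) then X e else 0
  outflow X v = sum λ e → if does (src G e ≟ v) then X e else 0

  IsFlow : EdgeFun → Set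
  IsFlow X = ∀ v → v ≢ s G → v ≢ t G → inflow X v ≡ outflow X v

  IsWalk : Node G → List (Edge G) → Node G → Set
  IsWalk u []       v = u ≡ v
  IsWalk u (e ∷ es) v = src G e ≡ u × IsWalk (tgt G e) es v

  record Path : Set where
    field
      pathEdges : List (Edge G)
      isWalk    : IsWalk (s G) pathEdges (t G)
      simple    : Unique (s G ∷ map (tgt G) pathEdges)

  open Path

  -- |X|, the total flow out of s
  value : EdgeFun → ℕ
  value X = outflow X (s G)

  pathFlow : Path → EdgeFun
  pathFlow P e = if does (e ∈? pathEdges P) then 1 else 0
    where open DecMembership (_≟_ {n = #edges G}) using (_∈?_)

  record Decomposition (X : EdgeFun) (k : ℕ) : Set where
    field
      paths      : Fin k → Path
      weights    : Fin k → ℕ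
      decomposes : ∀ e → X e ≡ sum λ i → weights i * pathFlow (paths i) e

  -- m is mfd_ℕ(G , X)
  IsMFD : EdgeFun → ℕ → Set
  IsMFD X m = Decomposition X m × (∀ k → Decomposition X k → m ≤ k)

  Carries : EdgeFun → Path → ℕ → Set
  Carries X P p = ∀ e → e ∈ pathEdges P → p ≤ X e

  Heaviest : EdgeFun → Path → ℕ → Set
  Heaviest X P p = Carries X P p × (∀ Q q → Carries X Q q → q ≤ p)

  -- No truncation occurs when P carries p in X.
  remaining : EdgeFun → Path → ℕ → EdgeFun
  remaining X P p e = X e ∸ p * pathFlow P e

  -- GreedyWeight X ds Y: starting from X, greedy-weight can (for some way of
  -- breaking ties) pick the weighted paths ds, in this order, and then have Y
  -- as remaining flow.  The run is complete when Y is 0; a bound on the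
  -- length of all runs, complete or not, also ensures termination.
  data GreedyWeight (X : EdgeFun) : List (Path × ℕ) → EdgeFun → Set where
    start : GreedyWeight X [] X
    pick  : ∀ {P p ds Y} → ¬ (∀ e → X e ≡ 0) → Heaviest X P p →
            GreedyWeight (remaining X P p) ds Y →
            GreedyWeight X ((P , p) ∷ ds) Y

-- k ≤ c · log₂ n over the reals, for n ≥ 1: both sides are exponentiated.
infix 4 _≤_·log₂_
_≤_·log₂_ : ℕ → ℕ → ℕ → Set
k ≤ c ·log₂ n = 2 ^ k ≤ n ^ c

{-# OPTIONS --safe #-}

-- A cut of a series-parallel graph is a potential on the nodes that is 0 at s,
-- 1 at t and non-decreasing along edges.  Every s-t path rises by 1 in total, so
-- the weights of the paths of any decomposition of X add up to the amount V of
-- flow through any cut.  By induction on the graph, if no path carries more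
-- than p, then some cut has flow at most p on each edge it crosses.  In an
-- optimal decomposition into k paths only k such crossings can carry flow (and
-- greedy-weight never adds flow to an edge), so V ≤ p k: each step of
-- greedy-weight multiplies V by at most 1 - 1/k ≤ k/(k + 1), and (1 + 1/k)^k ≥ 2.
module Submission where

open import Defs
open import Data.Bool.Base using (true; false; if_then_else_)
open import Data.Fin.Base using (Fin; zero; suc)
open import Data.Fin.Properties using (_≟_)
open import Data.List.Base using (List; []; _∷_; _++_; length; map)
open import Data.List.Membership.Propositional using (_∈_)
open import Data.List.Membership.Propositional.Properties
  using (∈-map⁻; ∈-++⁻)
import Data.List.Membership.DecPropositional as DecMembership
open import Data.List.Properties using (map-++; map-∘; map-cong)
open import Data.List.Relation.Unary.All as All using (All; []; _∷_)
open import Data.List.Relation.Unary.AllPairs using ([]; _∷_)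
open import Data.List.Relation.Unary.Any using (here)
open import Data.List.Relation.Unary.Unique.Propositional using (Unique)
import Data.List.Relation.Unary.Unique.Propositional.Properties as Unique
open import Data.Nat.Base
  using (ℕ; zero; suc; _+_; _*_; _∸_; _^_; _≤_; _<_; _>_; z≤n; s≤s; >-nonZero)
open import Data.Nat.ListAction using () renaming (sum to listSum)
open import Data.Nat.Properties hiding (_≟_)
open import Data.Nat.Tactic.RingSolver using (solve-∀)
open import Data.Product.Base using (∃-syntax; _×_; _,_; proj₁; proj₂)
open import Data.Sum.Base as Sum using (_⊎_; inj₁; inj₂; [_,_]′)
open import Function.Base using (_∘_; const)
open import Function.Bundles using (Inverse)
open import Function.Definitions using (Injective)
open import Relation.Binary.PropositionalEquality
  using (_≡_; _≢_; refl; sym; trans; cong; cong₂; subst; subst₂; module ≡-Reasoning)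
open import Relation.Nullary using (¬_; yes; no; does; contradiction)
open import Algebra.Properties.Semiring.Sum +-*-semiring
  using (sum-cong-≗; ∑-distrib-+; ∑-comm; *-distribˡ-sum)

open Graph
open Path

-- Finite sums

x∙yz≈y∙xz : ∀ x y z → x * (y * z) ≡ y * (x * z)
x∙yz≈y∙xz = solve-∀

sum-mono-≤ : ∀ {n} {f g : Fin n → ℕ} → (∀ i → f i ≤ g i) → sum f ≤ sum g
sum-mono-≤ {zero}  f≤g = z≤n
sum-mono-≤ {suc n} f≤g = +-mono-≤ (f≤g zero) (sum-mono-≤ (f≤g ∘ suc))

sum≡0⇒≡0 : ∀ {n} (f : Fin n → ℕ) → sum f ≡ 0 → ∀ i → f i ≡ 0
sum≡0⇒≡0 f eq zero    = m+n≡0⇒m≡0 (f zero) eq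
sum≡0⇒≡0 f eq (suc i) = sum≡0⇒≡0 (f ∘ suc) (m+n≡0⇒n≡0 (f zero) eq) i

sum-zero : ∀ {n} {f : Fin n → ℕ} → (∀ i → f i ≡ 0) → sum f ≡ 0
sum-zero {zero}  f≡0 = refl
sum-zero {suc n} f≡0 = cong₂ _+_ (f≡0 zero) (sum-zero (f≡0 ∘ suc))

sum-ones : ∀ {n} {f : Fin n → ℕ} → (∀ i → f i ≡ 1) → sum f ≡ n
sum-ones {zero}  f≡1 = refl
sum-ones {suc n} f≡1 = cong₂ _+_ (f≡1 zero) (sum-ones (f≡1 ∘ suc))

infix 8 ⟨_,_⟩
-- When the first argument is the crossing function of a cut, this pairing is the amount of flow
-- through the cut.
⟨_,_⟩ : ∀ {n} → (Fin n → ℕ) → (Fin n → ℕ) → ℕ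
⟨ f , g ⟩ = sum λ i → f i * g i

⟨⟩-combination : ∀ {n k} (f : Fin n → ℕ) (w : Fin k → ℕ) (F : Fin k → Fin n → ℕ) →
                 ⟨ f , (λ e → sum λ i → w i * F i e) ⟩ ≡ sum λ i → w i * ⟨ f , F i ⟩
⟨⟩-combination f w F = begin
  sum (λ e → f e * sum λ i → w i * F i e)
    ≡⟨ sum-cong-≗ (λ e → *-distribˡ-sum (f e) (λ i → w i * F i e)) ⟩
  sum (λ e → sum λ i → f e * (w i * F i e))
    ≡⟨ ∑-comm (λ e i → f e * (w i * F i e)) ⟩
  sum (λ i → sum λ e → f e * (w i * F i e))
    ≡⟨ sum-cong-≗ (λ i → sum-cong-≗ λ e → x∙yz≈y∙xz (f e) (w i) (F i e)) ⟩
  sum (λ i → sum λ e → w i * (f e * F i e))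
    ≡⟨ sum-cong-≗ (λ i → sym (*-distribˡ-sum (w i) (λ e → f e * F i e))) ⟩
  sum (λ i → w i * ⟨ f , F i ⟩) ∎
  where
  open ≡-Reasoning

⟨⟩-distribˡ-+ : ∀ {n} (f g h : Fin n → ℕ) →
                ⟨ f , (λ e → g e + h e) ⟩ ≡ ⟨ f , g ⟩ + ⟨ f , h ⟩
⟨⟩-distribˡ-+ f g h =
  trans (sum-cong-≗ λ e → *-distribˡ-+ (f e) (g e) (h e))
        (∑-distrib-+ (λ e → f e * g e) (λ e → f e * h e))

⟨⟩-*ʳ : ∀ {n} (f g : Fin n → ℕ) c → ⟨ f , (λ e → c * g e) ⟩ ≡ c * ⟨ f , g ⟩
⟨⟩-*ʳ f g c = trans (sum-cong-≗ λ e → x∙yz≈y∙xz (f e) c (g e))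
                    (sym (*-distribˡ-sum c (λ e → f e * g e)))

-- Has the same body as `pathFlow`, so facts about lists of edges apply to path flows by
-- definitional equality.
indicator : ∀ {n} → List (Fin n) → Fin n → ℕ
indicator es e = if does (e ∈? es) then 1 else 0
  where open DecMembership _≟_ using (_∈?_)

⟨⟩-point : ∀ {n} (f : Fin n → ℕ) x → ⟨ f , (λ e → if does (e ≟ x) then 1 else 0) ⟩ ≡ f x
⟨⟩-point f zero    =
  trans (cong₂ _+_ (*-identityʳ (f zero)) (sum-zero λ e → *-zeroʳ (f (suc e))))
        (+-identityʳ (f zero))
⟨⟩-point f (suc x) = cong₂ _+_ (*-zeroʳ (f zero)) (⟨⟩-point (f ∘ suc) x)

indicator-∷ : ∀ {n} {x : Fin n} {es} → All (x ≢_) es → ∀ e →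
              indicator (x ∷ es) e ≡ (if does (e ≟ x) then 1 else 0) + indicator es e
indicator-∷ {x = x} {es} x∉es e with e ≟ x | e ∈? es
  where open DecMembership _≟_ using (_∈?_)
... | no _     | yes _    = refl
... | no _     | no _     = refl
... | yes _    | no _     = refl
... | yes refl | yes e∈es = contradiction refl (All.lookup x∉es e∈es)

-- Membership counts each entry once, as does the list sum when there are no repetitions. The list
-- form is what lets rises telescope along a walk.
⟨⟩-indicator : ∀ {n} (f : Fin n → ℕ) {es} → Unique es →
               ⟨ f , indicator es ⟩ ≡ listSum (map f es)
⟨⟩-indicator f []                    = sum-zero λ e → *-zeroʳ (f e)
⟨⟩-indicator f {x ∷ es} (x∉es ∷ es!) = begin
  ⟨ f , indicator (x ∷ es) ⟩
    ≡⟨ sum-cong-≗ (λ e → cong (f e *_) (indicator-∷ x∉es e)) ⟩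
  ⟨ f , (λ e → (if does (e ≟ x) then 1 else 0) + indicator es e) ⟩
    ≡⟨ ⟨⟩-distribˡ-+ f _ (indicator es) ⟩
  ⟨ f , (λ e → if does (e ≟ x) then 1 else 0) ⟩ + ⟨ f , indicator es ⟩
    ≡⟨ cong₂ _+_ (⟨⟩-point f x) (⟨⟩-indicator f es!) ⟩
  f x + listSum (map f es) ∎
  where open ≡-Reasoning

-- Cuts

-- The truncated difference is the true one exactly where the potential does not decrease, hence the
-- companion notion `Monotone`.
rise : (G : Graph) → (Node G → ℕ) → Edge G → ℕ
rise G φ e = φ (tgt G e) ∸ φ (src G e)

Monotone : (G : Graph) → (Node G → ℕ) → Set
Monotone G φ = ∀ e → φ (src G e) ≤ φ (tgt G e)

-- Monotonicity forbids edges leading back through the cut. A path therefore crosses exactly once,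
-- whereas a general cut may be crossed several times in both directions.
record Cut (G : Graph) : Set where
  field
    side    : Node G → ℕ
    side-s  : side (s G) ≡ 0
    side-t  : side (t G) ≡ 1
    side-mono : Monotone G side

open Cut

crossing : ∀ {G} → Cut G → Edge G → ℕ
crossing {G} c = rise G (side c)

-- Telescoping sum, kept additive to avoid subtraction.
walk-rise : ∀ G {φ} → Monotone G φ → ∀ {u v} es → IsWalk G u es v →
            φ u + listSum (map (rise G φ) es) ≡ φ v
walk-rise G {φ} mono []       refl          = +-identityʳ _
walk-rise G {φ} mono (e ∷ es) (refl , walk) = begin
  φ (src G e) + (rise G φ e + listSum (map (rise G φ) es))
    ≡⟨ sym (+-assoc (φ (src G e)) _ _) ⟩
  φ (src G e) + rise G φ e + listSum (map (rise G φ) es)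
    ≡⟨ cong (_+ listSum (map (rise G φ) es)) (m+[n∸m]≡n (mono e)) ⟩
  φ (tgt G e) + listSum (map (rise G φ) es)
    ≡⟨ walk-rise G mono es walk ⟩
  _ ∎
  where open ≡-Reasoning

-- A simple path enters no node twice, so the targets of its edges are distinct and with them the
-- edges.
⟨⟩-pathFlow : ∀ {G} (f : Edge G → ℕ) (P : Path G) →
              ⟨ f , pathFlow G P ⟩ ≡ listSum (map f (pathEdges P))
⟨⟩-pathFlow f P with _ ∷ tgts! ← simple P = ⟨⟩-indicator f (Unique.map⁻ tgts!)

crossing-pathFlow : ∀ {G} (c : Cut G) (P : Path G) → ⟨ crossing c , pathFlow G P ⟩ ≡ 1
crossing-pathFlow {G} c P = begin
  ⟨ crossing c , pathFlow G P ⟩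
    ≡⟨ ⟨⟩-pathFlow (crossing c) P ⟩
  listSum (map (crossing c) (pathEdges P))
    ≡⟨ cong (_+ listSum (map (crossing c) (pathEdges P))) (sym (side-s c)) ⟩
  side c (s G) + listSum (map (crossing c) (pathEdges P))
    ≡⟨ walk-rise G {side c} (side-mono c) (pathEdges P) (isWalk P) ⟩
  side c (t G)
    ≡⟨ side-t c ⟩
  1 ∎
  where open ≡-Reasoning

-- Gluing potentials on the two parts of a composition

module Glue {G₁ G₂ G} (U : EdgeDisjointUnion G₁ G₂ G) where
  open EdgeDisjointUnion U

  left : Edge G₁ → Edge G
  left = Inverse.to edges ∘ inj₁

  right : Edge G₂ → Edge G
  right = Inverse.to edges ∘ inj₂

  -- Edges of a composition are known only up to the bijection `edges`; this reduces edgewise claims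
  -- to the two parts.
  edge-elim : (Q : Edge G → Set) → (∀ e → Q (left e)) → (∀ e → Q (right e)) → ∀ e → Q e
  edge-elim Q l r e with Inverse.from edges e in eq
  ... | inj₁ e₁ = subst Q (Inverse.inverseˡ edges (sym eq)) (l e₁)
  ... | inj₂ e₂ = subst Q (Inverse.inverseˡ edges (sym eq)) (r e₂)

  module _ (φ₁ : Node G₁ → ℕ) (φ₂ : Node G₂ → ℕ) where

    -- At a shared node `cover` may choose either part. The hypothesis `agree` below makes that
    -- choice irrelevant.
    glue : Node G → ℕ
    glue v = [ φ₁ ∘ proj₁ , φ₂ ∘ proj₁ ]′ (cover v)

    module _ (agree : ∀ {u v} → ι₁ u ≡ ι₂ v → φ₁ u ≡ φ₂ v) where

      glue-ι₁ : ∀ u → glue (ι₁ u) ≡ φ₁ u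
      glue-ι₁ u with cover (ι₁ u)
      ... | inj₁ (u′ , eq) = cong φ₁ (ι₁-inj eq)
      ... | inj₂ (v  , eq) = sym (agree (sym eq))

      glue-ι₂ : ∀ v → glue (ι₂ v) ≡ φ₂ v
      glue-ι₂ v with cover (ι₂ v)
      ... | inj₁ (u  , eq) = agree eq
      ... | inj₂ (v′ , eq) = cong φ₂ (ι₂-inj eq)

      glue-src-left : ∀ e → glue (src G (left e)) ≡ φ₁ (src G₁ e)
      glue-src-left e = trans (cong glue (src-edge (inj₁ e))) (glue-ι₁ _)

      glue-tgt-left : ∀ e → glue (tgt G (left e)) ≡ φ₁ (tgt G₁ e)
      glue-tgt-left e = trans (cong glue (tgt-edge (inj₁ e))) (glue-ι₁ _)

      glue-src-right : ∀ e → glue (src G (right e)) ≡ φ₂ (src G₂ e)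
      glue-src-right e = trans (cong glue (src-edge (inj₂ e))) (glue-ι₂ _)

      glue-tgt-right : ∀ e → glue (tgt G (right e)) ≡ φ₂ (tgt G₂ e)
      glue-tgt-right e = trans (cong glue (tgt-edge (inj₂ e))) (glue-ι₂ _)

      rise-left : ∀ e → rise G glue (left e) ≡ rise G₁ φ₁ e
      rise-left e = cong₂ _∸_ (glue-tgt-left e) (glue-src-left e)

      rise-right : ∀ e → rise G glue (right e) ≡ rise G₂ φ₂ e
      rise-right e = cong₂ _∸_ (glue-tgt-right e) (glue-src-right e)

      glue-mono : Monotone G₁ φ₁ → Monotone G₂ φ₂ → Monotone G glue
      glue-mono mono₁ mono₂ = edge-elim _
        (λ e → subst₂ _≤_ (sym (glue-src-left e)) (sym (glue-tgt-left e)) (mono₁ e))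
        (λ e → subst₂ _≤_ (sym (glue-src-right e)) (sym (glue-tgt-right e)) (mono₂ e))

open Glue

-- Cuts of single edges and of compositions

module _ {G} (S : SingleEdge G) where
  open SingleEdge S

  single-cut : Cut G
  single-cut = record
    { side   = φ
    ; side-s = φs
    ; side-t = φt
    ; side-mono = λ e → subst (_≤ φ (tgt G e)) (sym (trans (cong φ (src≡s e)) φs)) z≤n
    }
    where
    φ : Node G → ℕ
    φ v = if does (v ≟ s G) then 0 else 1
    φs : φ (s G) ≡ 0
    φs with s G ≟ s G
    ... | yes _  = refl
    ... | no s≢s = contradiction refl s≢s
    φt : φ (t G) ≡ 1
    φt with t G ≟ s G
    ... | yes t≡s = contradiction (sym t≡s) s≢t
    ... | no _    = refl
    src≡s : ∀ e → src G e ≡ s G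
    src≡s e = trans (cong (src G) (only e)) src-edge

  single-crossing : ∀ e → crossing single-cut e ≡ 1
  single-crossing e =
    trans (cong (crossing single-cut) (only e))
          (cong₂ _∸_ (trans (cong (side single-cut) tgt-edge) (side-t single-cut))
                     (trans (cong (side single-cut) src-edge) (side-s single-cut)))

  single-path : Path G
  single-path = record
    { pathEdges = edge ∷ []
    ; isWalk    = src-edge , tgt-edge
    ; simple    = ((λ s≡tgt → s≢t (trans s≡tgt tgt-edge)) ∷ []) ∷ [] ∷ []
    }

module _ {G₁ G₂ G} (C : ParallelComposition G₁ G₂ G) where
  open ParallelComposition C

  module _ (c₁ : Cut G₁) (c₂ : Cut G₂) where

    -- Only terminals are shared, and all cuts take the same values there.
    parallel-agree : ∀ {u v} → ι₁ u ≡ ι₂ v → side c₁ u ≡ side c₂ v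
    parallel-agree eq with shared eq
    ... | inj₁ (refl , refl) = trans (side-s c₁) (sym (side-s c₂))
    ... | inj₂ (refl , refl) = trans (side-t c₁) (sym (side-t c₂))

    parallel-cut : Cut G
    parallel-cut = record
      { side   = φ
      ; side-s = trans (cong φ s≡s₁) (trans (φ-ι₁ (s G₁)) (side-s c₁))
      ; side-t = trans (cong φ t≡t₁) (trans (φ-ι₁ (t G₁)) (side-t c₁))
      ; side-mono = glue-mono union (side c₁) (side c₂) parallel-agree (side-mono c₁) (side-mono c₂)
      }
      where
      φ    = glue union (side c₁) (side c₂)
      φ-ι₁ = glue-ι₁ union (side c₁) (side c₂) parallel-agree

    parallel-crossing-left : ∀ e → crossing parallel-cut (left union e) ≡ crossing c₁ e
    parallel-crossing-left = rise-left union (side c₁) (side c₂) parallel-agree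

    parallel-crossing-right : ∀ e → crossing parallel-cut (right union e) ≡ crossing c₂ e
    parallel-crossing-right = rise-right union (side c₁) (side c₂) parallel-agree

module _ {G₁ G₂ G} (C : SeriesComposition G₁ G₂ G) where
  open SeriesComposition C

  module _ (c : Cut G₁) where

    series-agreeˡ : ∀ {u v} → ι₁ u ≡ ι₂ v → side c u ≡ 1
    series-agreeˡ eq with refl , _ ← shared eq = side-t c

    -- The whole second part lies on the side of `t`, so only edges of the first part can cross.
    series-cutˡ : Cut G
    series-cutˡ = record
      { side   = φ
      ; side-s = trans (cong φ s≡s₁) (trans (glue-ι₁ union _ _ series-agreeˡ _) (side-s c))
      ; side-t = trans (cong φ t≡t₂) (glue-ι₂ union _ _ series-agreeˡ _)
      ; side-mono = glue-mono union _ _ series-agreeˡ (side-mono c) λ _ → ≤-refl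
      }
      where φ = glue union (side c) (const 1)

    seriesˡ-crossing-left : ∀ e → crossing series-cutˡ (left union e) ≡ crossing c e
    seriesˡ-crossing-left = rise-left union (side c) (const 1) series-agreeˡ

    seriesˡ-crossing-right : ∀ e → crossing series-cutˡ (right union e) ≡ 0
    seriesˡ-crossing-right = rise-right union (side c) (const 1) series-agreeˡ

  module _ (c : Cut G₂) where

    series-agreeʳ : ∀ {u v} → ι₁ u ≡ ι₂ v → 0 ≡ side c v
    series-agreeʳ eq with _ , refl ← shared eq = sym (side-s c)

    -- Mirror image: the whole first part lies on the side of `s`.
    series-cutʳ : Cut G
    series-cutʳ = record
      { side   = φ
      ; side-s = trans (cong φ s≡s₁) (glue-ι₁ union _ _ series-agreeʳ _)
      ; side-t = trans (cong φ t≡t₂) (trans (glue-ι₂ union _ _ series-agreeʳ _) (side-t c))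
      ; side-mono = glue-mono union _ _ series-agreeʳ (λ _ → ≤-refl) (side-mono c)
      }
      where φ = glue union (const 0) (side c)

    seriesʳ-crossing-left : ∀ e → crossing series-cutʳ (left union e) ≡ 0
    seriesʳ-crossing-left = rise-left union (const 0) (side c) series-agreeʳ

    seriesʳ-crossing-right : ∀ e → crossing series-cutʳ (right union e) ≡ crossing c e
    seriesʳ-crossing-right = rise-right union (const 0) (side c) series-agreeʳ

some-cut : ∀ {G} → SeriesParallel G → Cut G
some-cut (single S)         = single-cut S
some-cut (parallel sp₁ sp₂ C) = parallel-cut C (some-cut sp₁) (some-cut sp₂)
some-cut (series sp₁ sp₂ C)   = series-cutˡ C (some-cut sp₁)

-- Makes every edge visible to some cut, so that flow of cut value 0 must vanish. In a parallel
-- composition an arbitrary cut completes the one through the edge; in a series composition the part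
-- containing the edge is cut alone.
cut-through : ∀ {G} → SeriesParallel G → ∀ e → ∃[ c ] crossing {G} c e ≡ 1
cut-through (single S) e = single-cut S , single-crossing S e
cut-through (parallel sp₁ sp₂ C) = edge-elim (ParallelComposition.union C) _
  (λ e → let c , eq = cut-through sp₁ e in
    parallel-cut C c (some-cut sp₂) , trans (parallel-crossing-left C c (some-cut sp₂) e) eq)
  (λ e → let c , eq = cut-through sp₂ e in
    parallel-cut C (some-cut sp₁) c , trans (parallel-crossing-right C (some-cut sp₁) c e) eq)
cut-through (series sp₁ sp₂ C) = edge-elim (SeriesComposition.union C) _
  (λ e → let c , eq = cut-through sp₁ e in
    series-cutˡ C c , trans (seriesˡ-crossing-left C c e) eq)
  (λ e → let c , eq = cut-through sp₂ e in
    series-cutʳ C c , trans (seriesʳ-crossing-right C c e) eq)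

-- Paths in compositions

-- The data needed to carry paths from a part to the composite; injectivity on nodes keeps them
-- simple.
record Embedding (H G : Graph) : Set where
  field
    node     : Node H → Node G
    edge     : Edge H → Edge G
    node-inj : Injective _≡_ _≡_ node
    src-edge : ∀ e → src G (edge e) ≡ node (src H e)
    tgt-edge : ∀ e → tgt G (edge e) ≡ node (tgt H e)

open Embedding

module _ {G₁ G₂ G} (U : EdgeDisjointUnion G₁ G₂ G) where
  private module U = EdgeDisjointUnion U

  embedding₁ : Embedding G₁ G
  embedding₁ = record
    { node = U.ι₁ ; edge = left U ; node-inj = U.ι₁-inj
    ; src-edge = U.src-edge ∘ inj₁ ; tgt-edge = U.tgt-edge ∘ inj₁ }

  embedding₂ : Embedding G₂ G
  embedding₂ = record
    { node = U.ι₂ ; edge = right U ; node-inj = U.ι₂-inj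
    ; src-edge = U.src-edge ∘ inj₂ ; tgt-edge = U.tgt-edge ∘ inj₂ }

module _ {H G} (ε : Embedding H G) where

  embed-walk : ∀ {u v} es → IsWalk H u es v → IsWalk G (node ε u) (map (edge ε) es) (node ε v)
  embed-walk []       refl          = refl
  embed-walk (e ∷ es) (refl , walk) =
    src-edge ε e ,
    subst (λ u → IsWalk G u _ _) (sym (tgt-edge ε e)) (embed-walk es walk)

  embed-targets : ∀ es → map (tgt G) (map (edge ε) es) ≡ map (node ε) (map (tgt H) es)
  embed-targets es =
    trans (sym (map-∘ es)) (trans (map-cong (tgt-edge ε) es) (map-∘ es))

  embed-path : s G ≡ node ε (s H) → t G ≡ node ε (t H) → Path H → Path G
  embed-path s≡ t≡ P = record
    { pathEdges = map (edge ε) (pathEdges P)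
    ; isWalk    = subst₂ (λ u v → IsWalk G u _ v) (sym s≡) (sym t≡)
                    (embed-walk (pathEdges P) (isWalk P))
    ; simple    = subst Unique (sym (cong₂ _∷_ s≡ (embed-targets (pathEdges P))))
                    (Unique.map⁺ (node-inj ε) (simple P))
    }

  embed-carries : ∀ {X : EdgeFun G} {p es} → (∀ e → e ∈ es → p ≤ X (edge ε e)) →
                  ∀ e → e ∈ map (edge ε) es → p ≤ X e
  embed-carries p≤X e e∈ with e′ , e′∈ , refl ← ∈-map⁻ (edge ε) e∈ = p≤X e′ e′∈

walk-++ : ∀ G {u v w} es {fs} → IsWalk G u es v → IsWalk G v fs w → IsWalk G u (es ++ fs) w
walk-++ G []       refl          walk₂ = walk₂
walk-++ G (e ∷ es) (eq , walk₁) walk₂ = eq , walk-++ G es walk₁ walk₂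

module _ {G₁ G₂ G} (C : SeriesComposition G₁ G₂ G) where
  open SeriesComposition C
  private
    ε₁ = embedding₁ union
    ε₂ = embedding₂ union

  series-path : Path G₁ → Path G₂ → Path G
  series-path P₁ P₂ = record
    { pathEdges = map (edge ε₁) es₁ ++ map (edge ε₂) es₂
    ; isWalk    = walk-++ G (map (edge ε₁) es₁)
        (subst (λ u → IsWalk G u (map (edge ε₁) es₁) (ι₁ (t G₁))) (sym s≡s₁) (embed-walk ε₁ es₁ (isWalk P₁)))
        (subst₂ (λ u v → IsWalk G u (map (edge ε₂) es₂) v) (sym t₁≡s₂) (sym t≡t₂) (embed-walk ε₂ es₂ (isWalk P₂)))
    ; simple    = subst Unique (sym visited) distinct
    }
    where
    es₁ = pathEdges P₁
    es₂ = pathEdges P₂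
    tgts₂ = map (tgt G₂) es₂
    -- The joint node is counted with the first path only, as the end of that path; the second path
    -- contributes just its targets.
    visited : s G ∷ map (tgt G) (map (edge ε₁) es₁ ++ map (edge ε₂) es₂)
            ≡ map ι₁ (s G₁ ∷ map (tgt G₁) es₁) ++ map ι₂ tgts₂
    visited = cong₂ _∷_ s≡s₁
      (trans (map-++ (tgt G) (map (edge ε₁) es₁) _)
             (cong₂ _++_ (embed-targets ε₁ es₁) (embed-targets ε₂ es₂)))
    distinct : Unique (map ι₁ (s G₁ ∷ map (tgt G₁) es₁) ++ map ι₂ tgts₂)
    distinct with s₂∉ ∷ tgts₂! ← simple P₂ =
      Unique.++⁺ (Unique.map⁺ ι₁-inj (simple P₁)) (Unique.map⁺ ι₂-inj tgts₂!) disjoint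
      where
      disjoint : ∀ {v} → ¬ (v ∈ map ι₁ (s G₁ ∷ map (tgt G₁) es₁) × v ∈ map ι₂ tgts₂)
      -- A node on both sides would be the joint node, which starts the simple second path and so is
      -- not among its targets.
      disjoint (v∈₁ , v∈₂)
        with u₁ , _ , refl ← ∈-map⁻ ι₁ v∈₁
        with u₂ , u₂∈ , eq ← ∈-map⁻ ι₂ v∈₂
        = All.lookup s₂∉ u₂∈ (sym (proj₂ (shared eq)))

  series-carries : ∀ {X p} P₁ P₂ → Carries G₁ (X ∘ left union) P₁ p →
                   Carries G₂ (X ∘ right union) P₂ p → Carries G X (series-path P₁ P₂) p
  series-carries P₁ P₂ carries₁ carries₂ e e∈ with ∈-++⁻ (map (edge ε₁) (pathEdges P₁)) e∈
  ... | inj₁ e∈₁ = embed-carries ε₁ carries₁ e e∈₁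
  ... | inj₂ e∈₂ = embed-carries ε₂ carries₂ e e∈₂

-- Duality between bottleneck paths and bottleneck cuts

Bounded : ∀ {G} → EdgeFun G → ℕ → Cut G → Set
Bounded X p c = ∀ e → crossing c e ≡ 0 ⊎ X e ≤ p

-- The compositions exchange the roles of paths and cuts: in parallel, one path suffices and two
-- cuts are glued; in series, two paths are joined and one cut suffices. Over the naturals, carrying
-- `suc p` is the negation of a bottleneck of at most `p`.
bottleneck : ∀ {G} → SeriesParallel G → ∀ (X : EdgeFun G) p →
             (∃[ P ] Carries G X P (suc p)) ⊎ (∃[ c ] Bounded X p c)
bottleneck {G} (single S) X p with X (SingleEdge.edge S) ≤? p
... | yes X≤p = inj₂ (single-cut S , λ e →
                  inj₂ (subst (λ e → X e ≤ p) (sym (SingleEdge.only S e)) X≤p))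
... | no  X≰p = inj₁ (single-path S , λ { e (here refl) → ≰⇒> X≰p })
bottleneck (parallel sp₁ sp₂ C) X p
  with bottleneck sp₁ (X ∘ left U) p | bottleneck sp₂ (X ∘ right U) p
  where U = ParallelComposition.union C
... | inj₁ (P , carries) | _ =
  inj₁ (embed-path ε₁ s≡s₁ t≡t₁ P , embed-carries ε₁ carries)
  where
  open ParallelComposition C
  ε₁ = embedding₁ union
... | inj₂ _ | inj₁ (P , carries) =
  inj₁ (embed-path ε₂ s≡s₂ t≡t₂ P , embed-carries ε₂ carries)
  where
  open ParallelComposition C
  ε₂ = embedding₂ union
... | inj₂ (c₁ , bounded₁) | inj₂ (c₂ , bounded₂) =
  inj₂ (parallel-cut C c₁ c₂ , edge-elim union _
    (λ e → Sum.map₁ (trans (parallel-crossing-left C c₁ c₂ e)) (bounded₁ e))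
    (λ e → Sum.map₁ (trans (parallel-crossing-right C c₁ c₂ e)) (bounded₂ e)))
  where open ParallelComposition C
bottleneck (series sp₁ sp₂ C) X p
  with bottleneck sp₁ (X ∘ left U) p | bottleneck sp₂ (X ∘ right U) p
  where U = SeriesComposition.union C
... | inj₁ (P₁ , carries₁) | inj₁ (P₂ , carries₂) =
  inj₁ (series-path C P₁ P₂ , series-carries C P₁ P₂ carries₁ carries₂)
... | inj₂ (c , bounded) | _ =
  inj₂ (series-cutˡ C c , edge-elim (SeriesComposition.union C) _
    (λ e → Sum.map₁ (trans (seriesˡ-crossing-left C c e)) (bounded e))
    (λ e → inj₁ (seriesˡ-crossing-right C c e)))
... | inj₁ _ | inj₂ (c , bounded) =
  inj₂ (series-cutʳ C c , edge-elim (SeriesComposition.union C) _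
    (λ e → inj₁ (seriesʳ-crossing-left C c e))
    (λ e → Sum.map₁ (trans (seriesʳ-crossing-right C c e)) (bounded e)))

-- Greedy-weight

-- Flow conservation in the form used below: all cuts see the same amount.
CutValue : ∀ G → EdgeFun G → ℕ → Set
CutValue G X V = ∀ (c : Cut G) → ⟨ crossing c , X ⟩ ≡ V

SupportedOn : ∀ {n} → (Fin n → ℕ) → (Fin n → ℕ) → Set
SupportedOn c X = ∀ e → c e ≡ 0 → X e ≡ 0

m≤p⇒m≤p*n : ∀ {m n p} → m ≤ p → (n ≡ 0 → m ≡ 0) → m ≤ p * n
m≤p⇒m≤p*n {n = zero}      m≤p m≡0 rewrite m≡0 refl = z≤n
m≤p⇒m≤p*n {n = suc n} {p} m≤p m≡0 = ≤-trans m≤p (m≤m*n p (suc n))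

module _ {G} {X : EdgeFun G} {V} (value-X : CutValue G X V) where

  -- Think of `N` as counting the paths of a fixed `k`-path decomposition through each edge. No path
  -- carries `suc p`, so some cut has flow at most `p` on each edge it crosses; where that flow is
  -- nonzero, `N` is at least 1, so `p * N` dominates `X` there.
  heaviest-bound : SeriesParallel G → ∀ {N k P p} → CutValue G N k → SupportedOn N X →
                   Heaviest G X P p → V ≤ p * k
  heaviest-bound sp {N} {k} {P} {p} value-N supp (_ , maximal) with bottleneck sp X p
  ... | inj₁ (Q , carries) = contradiction (maximal Q (suc p) carries) 1+n≰n
  ... | inj₂ (c , bounded) = begin
    V                                   ≡⟨ sym (value-X c) ⟩
    ⟨ crossing c , X ⟩                  ≤⟨ sum-mono-≤ termwise ⟩
    ⟨ crossing c , (λ e → p * N e) ⟩    ≡⟨ ⟨⟩-*ʳ (crossing c) N p ⟩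
    p * ⟨ crossing c , N ⟩              ≡⟨ cong (p *_) (value-N c) ⟩
    p * k                               ∎
    where
    open ≤-Reasoning
    termwise : ∀ e → crossing c e * X e ≤ crossing c e * (p * N e)
    termwise e with bounded e
    ... | inj₁ eq rewrite eq = z≤n
    ... | inj₂ X≤p = *-monoʳ-≤ (crossing c e) (m≤p⇒m≤p*n X≤p (supp e))

  nonzero⇒value>0 : SeriesParallel G → ¬ (∀ e → X e ≡ 0) → 0 < V
  nonzero⇒value>0 sp X≢0 = n≢0⇒n>0 λ V≡0 → X≢0 λ e → zero-at V≡0 e (cut-through sp e)
    where
    zero-at : V ≡ 0 → ∀ e → ∃[ c ] crossing {G} c e ≡ 1 → X e ≡ 0
    zero-at V≡0 e (c , eq) = begin
      X e                  ≡⟨ sym (*-identityˡ (X e)) ⟩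
      1 * X e              ≡⟨ cong (_* X e) (sym eq) ⟩
      crossing c e * X e   ≡⟨ sum≡0⇒≡0 _ (trans (value-X c) V≡0) e ⟩
      0                    ∎
      where open ≡-Reasoning

  module _ {P : Path G} {p} (carries : Carries G X P p) where

    remaining-split : ∀ e → X e ≡ remaining G X P p e + p * pathFlow G P e
    remaining-split e = sym (m∸n+n≡m weight≤X)
      where
      open DecMembership (_≟_ {n = #edges G}) using (_∈?_)
      weight≤X : p * pathFlow G P e ≤ X e
      weight≤X with e ∈? pathEdges P
      ... | yes e∈P rewrite *-identityʳ p = carries e e∈P
      ... | no _    rewrite *-zeroʳ p     = z≤n

    -- The picked path crosses every cut exactly once, so each cut loses exactly `p`.
    crossing-remaining : ∀ c → ⟨ crossing c , remaining G X P p ⟩ + p ≡ V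
    crossing-remaining c = begin
      ⟨ crossing c , remaining G X P p ⟩ + p
        ≡⟨ cong (⟨ crossing c , remaining G X P p ⟩ +_) (sym p≡) ⟩
      ⟨ crossing c , remaining G X P p ⟩ + ⟨ crossing c , (λ e → p * pathFlow G P e) ⟩
        ≡⟨ sym (⟨⟩-distribˡ-+ (crossing c) _ _) ⟩
      ⟨ crossing c , (λ e → remaining G X P p e + p * pathFlow G P e) ⟩
        ≡⟨ sum-cong-≗ (λ e → cong (crossing c e *_) (sym (remaining-split e))) ⟩
      ⟨ crossing c , X ⟩
        ≡⟨ value-X c ⟩
      V ∎
      where
      open ≡-Reasoning
      p≡ : ⟨ crossing c , (λ e → p * pathFlow G P e) ⟩ ≡ p
      p≡ = trans (⟨⟩-*ʳ (crossing c) (pathFlow G P) p)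
                 (trans (cong (p *_) (crossing-pathFlow c P)) (*-identityʳ p))

    remaining-value : SeriesParallel G → ∃[ V′ ] V′ + p ≡ V × CutValue G (remaining G X P p) V′
    remaining-value sp = _ , crossing-remaining c₀ , λ c →
      +-cancelʳ-≡ p _ _ (trans (crossing-remaining c) (sym (crossing-remaining c₀)))
      -- Any one cut determines the new value; cancelling `p` shows that all others agree with it.
      where c₀ = some-cut sp

-- Since `V′` is at most `V`, it is at most `p * k`; adding `k * V′` to both sides gives the factor
-- k/(k + 1) without division.
value-decay : ∀ {V V′ p k} → V′ + p ≡ V → V ≤ p * k → suc k * V′ ≤ k * V
value-decay {V} {V′} {p} {k} refl V≤pk = begin
  V′ + k * V′           ≤⟨ +-monoˡ-≤ (k * V′) (≤-trans (m≤m+n V′ p) V≤pk) ⟩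
  p * k + k * V′        ≡⟨ rearrange p k V′ ⟩
  k * (V′ + p)          ∎
  where
  open ≤-Reasoning
  rearrange : ∀ p k V′ → p * k + k * V′ ≡ k * (V′ + p)
  rearrange = solve-∀

-- The value is bounded just before the last step, where it is still positive:
-- hence the offset between the length of the run and the exponents.
greedy-bound : ∀ {G} → SeriesParallel G → ∀ {N k} → CutValue G N k →
               ∀ {X V} → CutValue G X V → SupportedOn N X →
               ∀ {d ds Y} → GreedyWeight G X (d ∷ ds) Y →
               0 < k × suc k ^ length ds ≤ k ^ length ds * V
greedy-bound {G} sp {N} {k} value-N {X} {V} value-X supp
  (pick {P} {p} X≢0 heavy run) = k>0 , bound run
  where
  V>0 : 0 < V
  V>0 = nonzero⇒value>0 {X = X} value-X sp X≢0
  V≤pk : V ≤ p * k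
  V≤pk = heaviest-bound {X = X} value-X sp {P = P} value-N supp heavy
  k>0 : 0 < k
  k>0 = n≢0⇒n>0 λ { refl → <⇒≱ V>0 (≤-trans V≤pk (≤-reflexive (*-zeroʳ p))) }
  bound : ∀ {ds Y} → GreedyWeight G (remaining G X P p) ds Y → suc k ^ length ds ≤ k ^ length ds * V
  -- The run ends with this pick: both powers are 1, and only positivity of `V` is needed.
  bound start = ≤-trans V>0 (≤-reflexive (sym (*-identityˡ V)))
  bound {_ ∷ ds} run@(pick _ _ _)
    with V′ , V′+p≡V , value′ ← remaining-value {X = X} value-X {P} (proj₁ heavy) sp = begin
    -- The recursive bound concerns the run from the remaining flow, of value `V′`; one decay step
    -- then replaces `V′` by `V`.
    suc k * suc k ^ L       ≤⟨ *-monoʳ-≤ (suc k) (proj₂ (greedy-bound sp value-N value′ supp′ run)) ⟩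
    suc k * (k ^ L * V′)    ≡⟨ x∙yz≈y∙xz (suc k) (k ^ L) V′ ⟩
    k ^ L * (suc k * V′)    ≤⟨ *-monoʳ-≤ (k ^ L) (value-decay {p = p} V′+p≡V V≤pk) ⟩
    k ^ L * (k * V)         ≡⟨ x∙yz≈yx∙z (k ^ L) k V ⟩
    k * k ^ L * V           ∎
    where
    open ≤-Reasoning
    L = length ds
    x∙yz≈yx∙z : ∀ x y z → x * (y * z) ≡ y * x * z
    x∙yz≈yx∙z = solve-∀
    supp′ : SupportedOn N (remaining G X P p)
    supp′ e N≡0 = n≤0⇒n≡0 (≤-trans (m∸n≤m (X e) (p * pathFlow G P e)) (≤-reflexive (supp e N≡0)))

-- From geometric decay to a logarithm

-- Bernoulli's inequality (1 + 1/k)^n ≥ 1 + n/k with denominators cleared.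
bernoulli : ∀ k n → k ^ n * (k + n) ≤ k * suc k ^ n
bernoulli k zero    = ≤-reflexive (trans (+-identityʳ (k + 0)) (trans (+-identityʳ k) (sym (*-identityʳ k))))
bernoulli k (suc n) = begin
  -- The added term `k ^ n * n` makes the expression factor as `suc k` times the left side for `n`.
  k * k ^ n * (k + suc n)                     ≤⟨ m≤m+n _ (k ^ n * n) ⟩
  k * k ^ n * (k + suc n) + k ^ n * n         ≡⟨ expand k (k ^ n) n ⟩
  suc k * (k ^ n * (k + n))                   ≤⟨ *-monoʳ-≤ (suc k) (bernoulli k n) ⟩
  suc k * (k * suc k ^ n)                     ≡⟨ commute k (suc k ^ n) ⟩
  k * (suc k * suc k ^ n)                     ∎
  where
  open ≤-Reasoning
  expand : ∀ k a n → k * a * (k + suc n) + a * n ≡ suc k * (a * (k + n))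
  expand = solve-∀
  commute : ∀ k a → suc k * (k * a) ≡ k * (suc k * a)
  commute = solve-∀

-- The case n = k of Bernoulli's inequality, after cancelling `k`.
2*k^k≤[1+k]^k : ∀ k → 0 < k → 2 * k ^ k ≤ suc k ^ k
2*k^k≤[1+k]^k k@(suc _) _ = *-cancelˡ-≤ k (begin
  k * (2 * k ^ k)     ≡⟨ double k (k ^ k) ⟩
  k ^ k * (k + k)     ≤⟨ bernoulli k k ⟩
  k * suc k ^ k       ∎)
  where
  open ≤-Reasoning
  double : ∀ k a → k * (2 * a) ≡ a * (k + k)
  double = solve-∀

-- The hypothesis says (1 + 1/k)^L ≤ V. Its k-th power contains (1 + 1/k)^k, which is at least 2, to
-- the power `L`.
2^L≤V^k : ∀ {k} L {V} → 0 < k → suc k ^ L ≤ k ^ L * V → 2 ^ L ≤ V ^ k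
2^L≤V^k {k@(suc _)} L {V} k>0 h = *-cancelˡ-≤ ((k ^ k) ^ L) {{m^n≢0 (k ^ k) L {{m^n≢0 k k}}}} (begin
  (k ^ k) ^ L * 2 ^ L     ≡⟨ *-comm ((k ^ k) ^ L) (2 ^ L) ⟩
  2 ^ L * (k ^ k) ^ L     ≡⟨ sym (^-distribʳ-* L 2 (k ^ k)) ⟩
  (2 * k ^ k) ^ L         ≤⟨ ^-monoˡ-≤ L (2*k^k≤[1+k]^k k k>0) ⟩
  (suc k ^ k) ^ L         ≡⟨ ^-comm (suc k) k L ⟩
  (suc k ^ L) ^ k         ≤⟨ ^-monoˡ-≤ k h ⟩
  (k ^ L * V) ^ k         ≡⟨ ^-distribʳ-* k (k ^ L) V ⟩
  (k ^ L) ^ k * V ^ k     ≡⟨ cong (_* V ^ k) (^-comm k L k) ⟩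
  (k ^ k) ^ L * V ^ k     ∎)
  where
  open ≤-Reasoning
  ^-comm : ∀ a m n → (a ^ m) ^ n ≡ (a ^ n) ^ m
  ^-comm a m n = trans (^-*-assoc a m n) (trans (cong (a ^_) (*-comm m n)) (sym (^-*-assoc a n m)))
  ^-distribʳ-* : ∀ n a b → (a * b) ^ n ≡ a ^ n * b ^ n
  ^-distribʳ-* zero    a b = refl
  ^-distribʳ-* (suc n) a b = trans (cong (a * b *_) (^-distribʳ-* n a b)) (interchange a b (a ^ n) (b ^ n))
    where
    interchange : ∀ a b c d → a * b * (c * d) ≡ a * c * (b * d)
    interchange = solve-∀

-- Edge usage and total weight of a decomposition

module _ {G X k} (D : Decomposition G X k) where
  open Decomposition D

  usage : EdgeFun G
  usage e = sum λ i → pathFlow G (paths i) e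

  -- `usage` is the combination of the same paths with unit weights, and each of the `k` paths
  -- crosses the cut once.
  usage-value : CutValue G usage k
  usage-value c = begin
    ⟨ crossing c , usage ⟩
      ≡⟨ sum-cong-≗ (λ e → cong (crossing c e *_) (sum-cong-≗ λ i → sym (*-identityˡ (pathFlow G (paths i) e)))) ⟩
    ⟨ crossing c , (λ e → sum λ i → 1 * pathFlow G (paths i) e) ⟩
      ≡⟨ ⟨⟩-combination (crossing c) (const 1) (pathFlow G ∘ paths) ⟩
    sum (λ i → 1 * ⟨ crossing c , pathFlow G (paths i) ⟩)
      ≡⟨ sum-ones (λ i → trans (*-identityˡ _) (crossing-pathFlow c (paths i))) ⟩
    k ∎
    where open ≡-Reasoning

  usage-supports : SupportedOn usage X
  usage-supports e eq = trans (decomposes e) (sum-zero λ i →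
    trans (cong (weights i *_) (sum≡0⇒≡0 _ eq i)) (*-zeroʳ (weights i)))

  ⟨⟩-decomposes : ∀ f → ⟨ f , X ⟩ ≡ sum λ i → weights i * ⟨ f , pathFlow G (paths i) ⟩
  ⟨⟩-decomposes f = trans (sum-cong-≗ λ e → cong (f e *_) (decomposes e))
                          (⟨⟩-combination f weights (pathFlow G ∘ paths))

  cut-value : CutValue G X (sum weights)
  cut-value c = trans (⟨⟩-decomposes (crossing c)) (sum-cong-≗ λ i →
    trans (cong (weights i *_) (crossing-pathFlow c (paths i))) (*-identityʳ (weights i)))

  -- As the terminals differ, each path has a first edge, which leaves `s`; so each weight counts at
  -- least once in the outflow of `s`. An inequality is enough to replace the cut value by |X| in an
  -- upper bound.
  weights≤value : s G ≢ t G → sum weights ≤ value G X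
  weights≤value s≢t = begin
    sum weights
      ≤⟨ sum-mono-≤ (λ i → ≤-trans (≤-reflexive (sym (*-identityʳ (weights i))))
                                   (*-monoʳ-≤ (weights i) (leaves-s (paths i)))) ⟩
    sum (λ i → weights i * ⟨ from-s , pathFlow G (paths i) ⟩)
      ≡⟨ sym (⟨⟩-decomposes from-s) ⟩
    ⟨ from-s , X ⟩
      ≡⟨ sum-cong-≗ select ⟩
    value G X ∎
    where
    open ≤-Reasoning
    from-s : EdgeFun G
    from-s e = if does (src G e ≟ s G) then 1 else 0
    select : ∀ e → from-s e * X e ≡ (if does (src G e ≟ s G) then X e else 0)
    select e with does (src G e ≟ s G)
    ... | true  = *-identityˡ (X e)
    ... | false = refl
    walk-leaves-s : ∀ es → IsWalk G (s G) es (t G) → 1 ≤ listSum (map from-s es)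
    walk-leaves-s []       s≡t           = contradiction s≡t s≢t
    walk-leaves-s (e ∷ es) (src≡s , _) with src G e ≟ s G
    ... | yes _    = s≤s z≤n
    ... | no src≢s = contradiction src≡s src≢s
    leaves-s : ∀ P → 1 ≤ ⟨ from-s , pathFlow G P ⟩
    leaves-s P = ≤-trans (walk-leaves-s (pathEdges P) (isWalk P)) (≤-reflexive (sym (⟨⟩-pathFlow from-s P)))

cut⇒s≢t : ∀ {G} → Cut G → s G ≢ t G
cut⇒s≢t c s≡t = 0≢1+n (trans (sym (side-s c)) (trans (cong (side c) s≡t) (side-t c)))

corollary16 : ∃[ C ] C > 0 ×
    (∀ (G : Graph) → SeriesParallel G →
    ∀ (X : EdgeFun G) → IsFlow G X → 2 ≤ value G X →
    ∀ m → IsMFD G X m →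
    ∀ ds Y → GreedyWeight G X ds Y →
    length ds ≤ C * m ·log₂ value G X)
-- `greedy-bound` misses one pick of the run, so |X|^m bounds 2 to the length minus one. The missing
-- factor 2 is at most another |X|^m, as |X| ≥ 2 and m ≥ 1; hence the constant 2.
corollary16 = 2 , s≤s z≤n , bound
  where
  bound : ∀ (G : Graph) → SeriesParallel G →
          ∀ (X : EdgeFun G) → IsFlow G X → 2 ≤ value G X →
          ∀ m → IsMFD G X m →
          ∀ ds Y → GreedyWeight G X ds Y →
          length ds ≤ 2 * m ·log₂ value G X
  bound G sp X _ 2≤|X| m (D , _) [] Y run =
    m^n>0 (value G X) {{>-nonZero (≤-trans (s≤s z≤n) 2≤|X|)}} (2 * m)
  bound G sp X _ 2≤|X| m (D , _) (_ ∷ ds) Y run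
    with m>0 , h ← greedy-bound sp (usage-value D) (cut-value D) (usage-supports D) run = begin
    2 * 2 ^ length ds          ≤⟨ *-mono-≤ 2≤|X|^m 2^L≤|X|^m ⟩
    |X| ^ m * |X| ^ m          ≡⟨ sym (^-distribˡ-+-* |X| m m) ⟩
    |X| ^ (m + m)              ≡⟨ cong (λ n → |X| ^ (m + n)) (sym (+-identityʳ m)) ⟩
    |X| ^ (2 * m)              ∎
    where
    open ≤-Reasoning
    |X| = value G X
    2≤|X|^m : 2 ≤ |X| ^ m
    2≤|X|^m = ≤-trans (^-monoʳ-≤ 2 m>0) (^-monoˡ-≤ m 2≤|X|)
    2^L≤|X|^m : 2 ^ length ds ≤ |X| ^ m
    2^L≤|X|^m = ≤-trans (2^L≤V^k (length ds) m>0 h) (^-monoˡ-≤ m (weights≤value D (cut⇒s≢t (some-cut sp))))
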